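{- Let $T$ be a tournament that is not a transitive tournament of even order. Then there exists a set $R$ that is both an exact transversal and a minimum transversal of $\mathrm{mc}(T)$ such that $\mathcal M(T)$ is strictly bipartite by $R$. Moreover, $\mathrm{mc}(T)$ has the König property, i.e. $\nu(\mathrm{mc}(T))=\tau(\mathrm{mc}(T))$.
   Context: A tournament $T=(V(T),A(T))$ is a finite vertex set with, for every two distinct vertices $x,y$, exactly one of the arcs $(x,y),(y,x)$ in $A(T)$; its order is $|V(T)|$. $T$ is transitive if $(x,y),(y,z)\in A(T)$ implies $(x,z)\in A(T)$. For $X\subseteq V(T)$, $\overline X=V(T)\setminus X$. A module of $T$ is a set $M\subseteq V(T)$ such that for all $x,y\in M$ and $v\in V(T)\setminus M$, $(v,x)\in A(T)$ if and only if $(v,y)\in A(T)$. The trivial modules are $\varnothing$, the singletons $\{u\}$ ($u\in V(T)$) and $V(T)$. $\mathcal M(T)$ denotes the set of nontrivial modules of $T$. A co-module of $T$ is a set $M\subseteq V(T)$ such that $M$ or $\overline M$ is a nontrivial module of $T$. $\mathrm{mc}(T)$ denotes the set of co-modules of $T$ that are minimal under inclusion among all co-modules of $T$. Two sets $E,F$ overlap if $E\cap F$, $E\setminus F$ and $F\setminus E$ are all nonempty. Let $\mathcal F$ be a finite family of finite sets. $\mathcal F$ is strictly bipartite by a (finite) set $S$ if $S$ overlaps every element of $\mathcal F$. A transversal of $\mathcal F$ is a (finite) set $R$ with $F\cap R\ne\varnothing$ for every $F\in\mathcal F$; it is exact if $|F\cap R|=1$ for every $F\in\mathcal F$, and minimum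 if it has minimum size among transversals of $\mathcal F$. The transversal number $\tau(\mathcal F)$ is the size of a minimum transversal. A matching of $\mathcal F$ is a set of pairwise disjoint elements of $\mathcal F$, and the matching number $\nu(\mathcal F)$ is the maximum size of a matching. -}

module Defs where

open import Data.Fin.Base using (Fin)
open import Data.Fin.Subset
open import Data.List.Base using (List; length)
open import Data.List.Relation.Unary.All using (All)
open import Data.List.Relation.Unary.AllPairs using (AllPairs)
open import Data.List.Relation.Unary.Unique.Propositional using (Unique)
open import Data.Nat.Base using (ℕ; _≤_)
open import Data.Product.Base using (∃; ∃-syntax; _×_)
open import Data.Sum.Base using (_⊎_)
open import Function.Bundles using (_⇔_)
open import Level using (0ℓ)
open import Relation.Binary.Core using (Rel)
open import Relation.Binary.Definitions using (Transitive; Trichotomous)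
open import Relation.Binary.PropositionalEquality using (_≡_)
open import Relation.Nullary using (¬_)
open import Relation.Unary using (Pred)

-- The vertex set is Fin n, so n is the order.  Trichotomy says that exactly
-- one of  Arc x y,  x ≡ y,  Arc y x  holds: there are no loops, and two
-- distinct vertices are joined by exactly one arc.
record Tournament (n : ℕ) : Set₁ where
  field
    Arc     : Rel (Fin n) 0ℓ
    compare : Trichotomous _≡_ Arc

Family : ℕ → Set₁
Family n = Pred (Subset n) 0ℓ

module _ {n : ℕ} where

  Overlap : Subset n → Subset n → Set
  Overlap E F = Nonempty (E ∩ F) × Nonempty (E ─ F) × Nonempty (F ─ E)

  StrictlyBipartiteBy : Family n → Subset n → Set
  StrictlyBipartiteBy 𝓕 S = ∀ F → 𝓕 F → Overlap S F

  IsTransversal : Family n → Subset n → Set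
  IsTransversal 𝓕 R = ∀ F → 𝓕 F → Nonempty (F ∩ R)

  IsExactTransversal : Family n → Subset n → Set
  IsExactTransversal 𝓕 R =
    IsTransversal 𝓕 R × (∀ F → 𝓕 F → ∣ F ∩ R ∣ ≡ 1)

  IsMinimumTransversal : Family n → Subset n → Set
  IsMinimumTransversal 𝓕 R =
    IsTransversal 𝓕 R × (∀ R′ → IsTransversal 𝓕 R′ → ∣ R ∣ ≤ ∣ R′ ∣)

  -- A matching is a set of sets, represented by a repetition-free list, whose
  -- length is then its size.  Unique is not implied by disjointness, as the
  -- empty set is disjoint from itself.
  IsMatching : Family n → List (Subset n) → Set
  IsMatching 𝓕 Es =
    All 𝓕 Es × Unique Es × AllPairs (λ E F → Empty (E ∩ F)) Es

  -- τ and ν are given as relations "k is the number", since an arbitrary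
  -- family need not be decidable and need not have a transversal.  In each
  -- case at most one k qualifies.
  IsTransversalNumber : Family n → ℕ → Set
  IsTransversalNumber 𝓕 k = ∃[ R ] (IsMinimumTransversal 𝓕 R × ∣ R ∣ ≡ k)

  IsMatchingNumber : Family n → ℕ → Set
  IsMatchingNumber 𝓕 k =
    (∃[ Es ] (IsMatching 𝓕 Es × length Es ≡ k)) ×
    (∀ Es → IsMatching 𝓕 Es → length Es ≤ k)

  -- Both numbers exist and they are equal.
  König : Family n → Set
  König 𝓕 =
    ∃[ ν ] ∃[ τ ] (IsMatchingNumber 𝓕 ν × IsTransversalNumber 𝓕 τ × ν ≡ τ)

  Trivial : Subset n → Set
  Trivial M = M ≡ ⊥ ⊎ (∃[ u ] M ≡ ⁅ u ⁆) ⊎ M ≡ ⊤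

module _ {n : ℕ} (T : Tournament n) where
  open Tournament T

  IsTransitive : Set
  IsTransitive = Transitive Arc

  IsModule : Subset n → Set
  IsModule M = ∀ x y v → x ∈ M → y ∈ M → v ∉ M → Arc v x ⇔ Arc v y

  𝓜 : Family n
  𝓜 M = IsModule M × ¬ Trivial M

  IsCoModule : Subset n → Set
  IsCoModule M = 𝓜 M ⊎ 𝓜 (∁ M)

  mc : Family n
  mc M = IsCoModule M × (∀ N → IsCoModule N → N ⊆ M → N ≡ M)

{-# OPTIONS --safe #-}
module Submission where

{- Two minimal co-modules that meet are both pairs {x, y} that are modules
("twins"), since otherwise an intersection, a difference or the complement of
a union would be a smaller co-module.  Each vertex has at most one twin on
either side, so these pairs form directed paths, and every other minimal
co-module is disjoint from all the rest.  R takes every second vertex of each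
path, leaving out one of its ends (the anchor), and one vertex of every other
minimal co-module.  Charging a path vertex of R to the pair joining it to its
neighbour on the side of the anchor gives a matching of size |R|.

A nontrivial module contained in R contains only singletons as minimal
co-modules, which forces it to be {s, x} with s a source or a sink.  Such an x
is called bad, and R avoids the bad vertices.  On a path, a bad vertex is an
end and can serve as the anchor.  If both ends are bad, the tournament is
transitive and the ends have scores n - 2 and 1; as scores drop by one along a
path, both ends can be left out exactly when n is odd. -}

open import Defs
open import Data.Bool.Base using (true)
import Data.Bool.Properties as Bool
open import Data.Empty using (⊥-elim)
open import Data.Fin.Base using (Fin; zero; suc)
open import Data.Fin.Properties using (any?; all?; _≟_; 0≢1+n)
import Data.Fin.Properties as Fin
open import Data.Fin.Subset
open import Data.Fin.Subset.Properties
open import Data.Fin.Subset.Induction using (⊂-wellFounded; Acc; acc)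
open import Data.List.Base using (List; []; _∷_; length)
open import Data.List.Relation.Unary.All using (All; []; _∷_)
import Data.List.Relation.Unary.All as All
open import Data.List.Relation.Unary.AllPairs using (AllPairs; []; _∷_)
open import Data.Maybe.Base using (Maybe; just)
import Data.Maybe.Base as Maybe
import Data.Maybe.Properties as Maybe
open import Data.Nat.Base using (ℕ; zero; suc; _≤_; z≤n; s≤s; parity)
open import Data.Nat.Divisibility using (_∣_; _∣0; ∣-refl; ∣m∣n⇒∣m+n)
import Data.Nat.Base as ℕ
import Data.Nat.Properties as ℕ
open import Data.Parity.Base using (0ℙ; 1ℙ)
import Data.Parity.Base as ℙ
import Data.Parity.Properties as ℙ
open import Data.Product.Base using (∃; ∃-syntax; _×_; _,_; proj₁; proj₂)
open import Data.Sum.Base using (_⊎_; inj₁; inj₂; [_,_]′)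
open import Data.Vec.Base using ([]; _∷_; here; there; tabulate)
open import Data.Vec.Properties using ([]=⇒lookup; lookup⇒[]=; lookup∘tabulate)
import Data.Vec.Properties as Vec
open import Function.Base using (_∘_; id)
open import Function.Bundles using (_⇔_; mk⇔; Equivalence)
open import Relation.Binary.Construct.Closure.ReflexiveTransitive using (Star; ε; _◅_; _◅◅_)
open import Level using (0ℓ)
open import Relation.Binary.Core using (Rel)
open import Relation.Binary.Definitions using (DecidableEquality; tri<; tri≈; tri>)
open import Relation.Binary.PropositionalEquality
open import Relation.Nullary using (¬_; Dec; yes; no; does; contradiction; ¬?)
open import Relation.Nullary.Decidable using (map′; _×-dec_; _⊎-dec_; _→-dec_; dec-true; dec⇒maybe; decidable-stable)
open import Relation.Unary using (Pred; Decidable)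

-- Finite subsets, pairs and nontriviality.

_≟ˢ_ : ∀ {n} → DecidableEquality (Subset n)
_≟ˢ_ = Vec.≡-dec Bool._≟_

even⇒2∣ : ∀ n → parity n ≡ 0ℙ → 2 ∣ n
even⇒2∣ zero          _    = 2 ∣0
even⇒2∣ (suc (suc n)) even = ∣m∣n⇒∣m+n ∣-refl (even⇒2∣ n even)

module _ {n : ℕ} where

  pair : Fin n → Fin n → Subset n
  pair x y = ⁅ x ⁆ ∪ ⁅ y ⁆

  ∈-pairˡ : ∀ {x y} → x ∈ pair x y
  ∈-pairˡ {x} = x∈p∪q⁺ (inj₁ (x∈⁅x⁆ x))

  ∈-pairʳ : ∀ {x y} → y ∈ pair x y
  ∈-pairʳ {_} {y} = x∈p∪q⁺ (inj₂ (x∈⁅x⁆ y))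

  ∈-pair⁻ : ∀ {x y v} → v ∈ pair x y → v ≡ x ⊎ v ≡ y
  ∈-pair⁻ {x} {y} v∈ with x∈p∪q⁻ ⁅ x ⁆ ⁅ y ⁆ v∈
  ... | inj₁ v∈x = inj₁ (x∈⁅y⁆⇒x≡y x v∈x)
  ... | inj₂ v∈y = inj₂ (x∈⁅y⁆⇒x≡y y v∈y)

  ∉-pair : ∀ {x y v} → v ≢ x → v ≢ y → v ∉ pair x y
  ∉-pair v≢x v≢y = [ v≢x , v≢y ]′ ∘ ∈-pair⁻

  ≡-pair : ∀ {x y} {M : Subset n} → x ∈ M → y ∈ M → (∀ {v} → v ∈ M → v ≡ x ⊎ v ≡ y) → M ≡ pair x y
  ≡-pair x∈M y∈M only = ⊆-antisym
    ([ (λ { refl → ∈-pairˡ }) , (λ { refl → ∈-pairʳ }) ]′ ∘ only)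
    ([ (λ { refl → x∈M }) , (λ { refl → y∈M }) ]′ ∘ ∈-pair⁻)

  ≡-singleton : ∀ {x} {M : Subset n} → x ∈ M → (∀ {v} → v ∈ M → v ≡ x) → M ≡ ⁅ x ⁆
  ≡-singleton {x} {M} x∈M only = ⊆-antisym
    (λ v∈M → subst (_∈ ⁅ x ⁆) (sym (only v∈M)) (x∈⁅x⁆ x))
    (λ v∈x → subst (_∈ M) (sym (x∈⁅y⁆⇒x≡y x v∈x)) x∈M)

  unique⇒∣∣≡1 : ∀ {x} {M : Subset n} → x ∈ M → (∀ {v} → v ∈ M → v ≡ x) → ∣ M ∣ ≡ 1
  unique⇒∣∣≡1 {x} x∈M only = trans (cong ∣_∣ (≡-singleton x∈M only)) (∣⁅x⁆∣≡1 x)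

  ⊆-or-∃ : ∀ (E F : Subset n) → E ⊆ F ⊎ (∃[ v ] v ∈ E × v ∉ F)
  ⊆-or-∃ E F with any? (λ v → (v ∈? E) ×-dec ¬? (v ∈? F))
  ... | yes w = inj₂ w
  ... | no ¬w = inj₁ λ {v} v∈E → decidable-stable (v ∈? F) λ v∉F → ¬w (v , v∈E , v∉F)

  ∣p∪⁅x⁆∣≡1+∣p∣ : ∀ {x} {p : Subset n} → x ∉ p → ∣ p ∪ ⁅ x ⁆ ∣ ≡ suc ∣ p ∣
  ∣p∪⁅x⁆∣≡1+∣p∣ = go _ _
    where
    go : ∀ {m} (x : Fin m) (p : Subset m) → x ∉ p → ∣ p ∪ ⁅ x ⁆ ∣ ≡ suc ∣ p ∣
    go zero (inside ∷ p) x∉ = contradiction here x∉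
    go zero (outside ∷ p) x∉ = cong (suc ∘ ∣_∣) (∪-identityʳ p)
    go (suc x) (inside ∷ p) x∉ = cong suc (go x p (x∉ ∘ there))
    go (suc x) (outside ∷ p) x∉ = go x p (x∉ ∘ there)

  Proper : Subset n → Set
  Proper M = ∃[ x ] ∃[ y ] ∃[ v ] (x ∈ M × y ∈ M × x ≢ y × v ∉ M)

  Proper⇒¬Trivial : ∀ {M} → Proper M → ¬ Trivial M
  Proper⇒¬Trivial (x , _ , _ , x∈M , _) (inj₁ refl) = ∉⊥ x∈M
  Proper⇒¬Trivial (x , y , _ , x∈M , y∈M , x≢y , _) (inj₂ (inj₁ (u , refl))) =
    x≢y (trans (x∈⁅y⁆⇒x≡y u x∈M) (sym (x∈⁅y⁆⇒x≡y u y∈M)))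
  Proper⇒¬Trivial (_ , _ , v , _ , _ , _ , v∉M) (inj₂ (inj₂ refl)) = v∉M ∈⊤

  ¬Trivial⇒Proper : ∀ {M} → ¬ Trivial M → Proper M
  ¬Trivial⇒Proper {M} nt with nonempty? M
  ... | no ¬ne = contradiction (inj₁ (Empty-unique {p = M} ¬ne)) nt
  ... | yes (x , x∈M) with ⊆-or-∃ M ⁅ x ⁆ | ⊆-or-∃ ⊤ M
  ...   | inj₁ M⊆x | _ =
          contradiction (inj₂ (inj₁ (x , ≡-singleton x∈M (x∈⁅y⁆⇒x≡y x ∘ M⊆x)))) nt
  ...   | _ | inj₁ ⊤⊆M = contradiction (inj₂ (inj₂ (⊆-antisym ⊆⊤ ⊤⊆M))) nt
  ...   | inj₂ (y , y∈M , y∉x) | inj₂ (v , _ , v∉M) =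
          x , y , v , x∈M , y∈M , (λ { refl → y∉x (x∈⁅x⁆ x) }) , v∉M

  -- `M` supplies two distinct elements and a non-element; `x` and `y` cannot account for all three.
  third-vertex : ∀ {M} → Proper M → ∀ x y → ∃[ v ] v ≢ x × v ≢ y
  third-vertex (a , b , c , a∈M , b∈M , a≢b , c∉M) x y
    with any? (λ v → ¬? (v ≟ x) ×-dec ¬? (v ≟ y))
  ... | yes w = w
  ... | no ¬w = ⊥-elim (clash (x-or-y a) (x-or-y b) (x-or-y c))
    where
    x-or-y : ∀ v → v ≡ x ⊎ v ≡ y
    x-or-y v with v ≟ x | v ≟ y
    ... | yes v≡x | _ = inj₁ v≡x
    ... | _ | yes v≡y = inj₂ v≡y
    ... | no v≢x | no v≢y = contradiction (v , v≢x , v≢y) ¬w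
    a≢c : a ≢ c
    a≢c refl = c∉M a∈M
    b≢c : b ≢ c
    b≢c refl = c∉M b∈M
    clash : a ≡ x ⊎ a ≡ y → b ≡ x ⊎ b ≡ y → c ≡ x ⊎ c ≡ y → Data.Empty.⊥
    clash (inj₁ p) (inj₁ q) _ = a≢b (trans p (sym q))
    clash (inj₂ p) (inj₂ q) _ = a≢b (trans p (sym q))
    clash (inj₁ p) (inj₂ q) (inj₁ r) = a≢c (trans p (sym r))
    clash (inj₁ p) (inj₂ q) (inj₂ r) = b≢c (trans q (sym r))
    clash (inj₂ p) (inj₁ q) (inj₁ r) = b≢c (trans q (sym r))
    clash (inj₂ p) (inj₁ q) (inj₂ r) = a≢c (trans p (sym r))

-- Subsets cut out by decidable predicates.

module _ {n : ℕ} {P : Pred (Fin n) 0ℓ} (P? : Decidable P) where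

  ⟦_⟧ : Subset n
  ⟦_⟧ = tabulate (does ∘ P?)

  ∈-⟦⟧⁺ : ∀ {x} → P x → x ∈ ⟦_⟧
  ∈-⟦⟧⁺ {x} Px = lookup⇒[]= x _ (trans (lookup∘tabulate (does ∘ P?) x) (dec-true (P? x) Px))

  ∈-⟦⟧⁻ : ∀ {x} → x ∈ ⟦_⟧ → P x
  ∈-⟦⟧⁻ {x} x∈ = from-does (P? x) (trans (sym (lookup∘tabulate (does ∘ P?) x)) ([]=⇒lookup x∈))
    where
    from-does : ∀ {A : Set} (a? : Dec A) → does a? ≡ true → A
    from-does (yes a) _ = a

-- Images of subsets; matchings against transversals.

module _ {A : Set} where

  -- One entry per element of `R`, so the length is `∣ R ∣` whether or not `f` is injective on `R`.
  image : ∀ {n} → Subset n → (Fin n → A) → List A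
  image []            f = []
  image (inside ∷ R)  f = f zero ∷ image R (f ∘ suc)
  image (outside ∷ R) f = image R (f ∘ suc)

  length-image : ∀ {n} (R : Subset n) f → length (image R f) ≡ ∣ R ∣
  length-image []            f = refl
  length-image (inside ∷ R)  f = cong suc (length-image R (f ∘ suc))
  length-image (outside ∷ R) f = length-image R (f ∘ suc)

  All-image : ∀ {n} {P : Pred A 0ℓ} (R : Subset n) f → (∀ {r} → r ∈ R → P (f r)) → All P (image R f)
  All-image []            f h = []
  All-image (inside ∷ R)  f h = h here ∷ All-image R (f ∘ suc) (h ∘ there)
  All-image (outside ∷ R) f h = All-image R (f ∘ suc) (h ∘ there)

  AllPairs-image : ∀ {n} {Q : Rel A 0ℓ} (R : Subset n) f →
    (∀ {r r′} → r ∈ R → r′ ∈ R → r ≢ r′ → Q (f r) (f r′)) → AllPairs Q (image R f)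
  AllPairs-image []            f h = []
  AllPairs-image (inside ∷ R)  f h =
    All-image R (f ∘ suc) (λ r∈R → h here (there r∈R) 0≢1+n) ∷
    AllPairs-image R (f ∘ suc) (λ r∈R r′∈R r≢r′ → h (there r∈R) (there r′∈R) (r≢r′ ∘ Fin.suc-injective))
  AllPairs-image (outside ∷ R) f h =
    AllPairs-image R (f ∘ suc) (λ r∈R r′∈R r≢r′ → h (there r∈R) (there r′∈R) (r≢r′ ∘ Fin.suc-injective))

-- Remove from `R` a point `r` of the first member; the other members are disjoint from that member,
-- so they still meet `R - r`.
∣matching∣≤∣transversal∣ : ∀ {n} (Es : List (Subset n)) (R : Subset n) →
  All (λ E → Nonempty (E ∩ R)) Es → AllPairs (λ E F → Empty (E ∩ F)) Es → length Es ≤ ∣ R ∣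
∣matching∣≤∣transversal∣ [] R _ _ = z≤n
∣matching∣≤∣transversal∣ (E ∷ Es) R ((r , r∈E∩R) ∷ meet) (disj ∷ disjs)
  with r∈E , r∈R ← x∈p∩q⁻ E R r∈E∩R =
  ℕ.≤-trans
    (s≤s (∣matching∣≤∣transversal∣ Es (R - r) (All.zipWith avoid-r (disj , meet)) disjs))
    (x∈p⇒∣p-x∣<∣p∣ r∈R)
  where
  avoid-r : ∀ {F} → Empty (E ∩ F) × Nonempty (F ∩ R) → Nonempty (F ∩ (R - r))
  avoid-r {F} (E∩F≡∅ , x , x∈F∩R) with x∈F , x∈R ← x∈p∩q⁻ F R x∈F∩R =
    x , x∈p∩q⁺ (x∈F , x∈p∧x≢y⇒x∈p-y x∈R
      λ { refl → E∩F≡∅ (x , x∈p∩q⁺ (proj₁ (x∈p∩q⁻ E R r∈E∩R) , x∈F)) })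

-- A transversal whose elements can be charged to pairwise disjoint members of
-- the family is minimum, and these members form a maximum matching.
module _ {n : ℕ} {𝓕 : Family n} {R : Subset n} (R-trans : IsTransversal 𝓕 R)
         (member : Fin n → Subset n)
         (member∈𝓕 : ∀ {r} → r ∈ R → 𝓕 (member r))
         (r∈member : ∀ {r} → r ∈ R → r ∈ member r)
         (disjoint : ∀ {r r′} → r ∈ R → r′ ∈ R → r ≢ r′ → Empty (member r ∩ member r′)) where

  private
    Es : List (Subset n)
    Es = image R member

    Es-matching : IsMatching 𝓕 Es
    Es-matching =
      All-image R member member∈𝓕 ,
      -- Disjoint members are distinct because each contains its own `r`.
      AllPairs-image R member (λ {r} r∈R r′∈R r≢r′ eq → disjoint r∈R r′∈R r≢r′
        (r , x∈p∩q⁺ (r∈member r∈R , subst (r ∈_) eq (r∈member r∈R)))) ,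
      AllPairs-image R member disjoint

    bound : ∀ Fs R′ → IsMatching 𝓕 Fs → IsTransversal 𝓕 R′ → length Fs ≤ ∣ R′ ∣
    bound Fs R′ (Fs⊆𝓕 , _ , disj) R′-trans =
      ∣matching∣≤∣transversal∣ Fs R′ (All.map (R′-trans _) Fs⊆𝓕) disj

  charged⇒minimum : IsMinimumTransversal 𝓕 R
  charged⇒minimum = R-trans , λ R′ R′-trans →
    subst (_≤ ∣ R′ ∣) (length-image R member) (bound Es R′ Es-matching R′-trans)

  charged⇒König : König 𝓕
  charged⇒König = ∣ R ∣ , ∣ R ∣ ,
    ((Es , Es-matching , length-image R member) , λ Fs m → bound Fs R m R-trans) ,
    (R , charged⇒minimum , refl) , refl

-- Arcs, modules and their Boolean combinations.

module _ {n : ℕ} (T : Tournament n) where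
  open Tournament T

  abstract
    arc? : ∀ x y → Dec (Arc x y)
    arc? x y with compare x y
    ... | tri< xy _ _ = yes xy
    ... | tri≈ ¬xy _ _ = no ¬xy
    ... | tri> ¬xy _ _ = no ¬xy

  asym : ∀ {x y} → Arc x y → ¬ Arc y x
  asym {x} {y} xy with compare x y
  ... | tri< _ _ ¬yx = ¬yx
  ... | tri≈ ¬xy _ _ = contradiction xy ¬xy
  ... | tri> ¬xy _ _ = contradiction xy ¬xy

  arc⇒≢ : ∀ {x y} → Arc x y → x ≢ y
  arc⇒≢ xx refl = asym xx xx

  total : ∀ {x y} → x ≢ y → Arc x y ⊎ Arc y x
  total {x} {y} x≢y with compare x y
  ... | tri< xy _ _ = inj₁ xy
  ... | tri≈ _ x≡y _ = contradiction x≡y x≢y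
  ... | tri> _ _ yx = inj₂ yx

  module-in : ∀ {M x y v} → IsModule T M → x ∈ M → y ∈ M → v ∉ M → Arc v x → Arc v y
  module-in mod x∈M y∈M v∉M = Equivalence.to (mod _ _ _ x∈M y∈M v∉M)

  module-out : ∀ {M x y v} → IsModule T M → x ∈ M → y ∈ M → v ∉ M → Arc x v → Arc y v
  module-out {M} mod x∈M y∈M v∉M xv with total (λ y≡v → v∉M (subst (_∈ M) y≡v y∈M))
  ... | inj₁ yv = yv
  ... | inj₂ vy = contradiction xv (asym (module-in mod y∈M x∈M v∉M vy))

  mkModule : ∀ {M} → (∀ {x y v} → x ∈ M → y ∈ M → v ∉ M → Arc v x → Arc v y) → IsModule T M
  mkModule h x y v x∈M y∈M v∉M = mk⇔ (h x∈M y∈M v∉M) (h y∈M x∈M v∉M)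

  ∩-module : ∀ {M N} → IsModule T M → IsModule T N → IsModule T (M ∩ N)
  ∩-module {M} {N} modM modN = mkModule go
    where
    go : ∀ {x y v} → x ∈ M ∩ N → y ∈ M ∩ N → v ∉ M ∩ N → Arc v x → Arc v y
    go {v = v} x∈ y∈ v∉
      with x∈M , x∈N ← x∈p∩q⁻ M N x∈ | y∈M , y∈N ← x∈p∩q⁻ M N y∈ | v ∈? M
    ... | no v∉M = module-in modM x∈M y∈M v∉M
    ... | yes v∈M = module-in modN x∈N y∈N (λ v∈N → v∉ (x∈p∩q⁺ (v∈M , v∈N)))

  -- Arcs are carried from `x` to `y` through the common vertex `z`. The union `K` is described by
  -- inclusions because it will be the complement of an intersection.
  ∪-module : ∀ {M N K z} → IsModule T M → IsModule T N → z ∈ M → z ∈ N →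
    M ⊆ K → N ⊆ K → (∀ {v} → v ∈ K → v ∈ M ⊎ v ∈ N) → IsModule T K
  ∪-module {M} {N} {K} {z} modM modN z∈M z∈N M⊆K N⊆K split = mkModule go
    where
    go : ∀ {x y v} → x ∈ K → y ∈ K → v ∉ K → Arc v x → Arc v y
    go {x} {y} {v} x∈K y∈K v∉K = from-z (split y∈K) ∘ to-z (split x∈K)
      where
      to-z : x ∈ M ⊎ x ∈ N → Arc v x → Arc v z
      to-z (inj₁ x∈M) = module-in modM x∈M z∈M (v∉K ∘ M⊆K)
      to-z (inj₂ x∈N) = module-in modN x∈N z∈N (v∉K ∘ N⊆K)
      from-z : y ∈ M ⊎ y ∈ N → Arc v z → Arc v y
      from-z (inj₁ y∈M) = module-in modM z∈M y∈M (v∉K ∘ M⊆K)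
      from-z (inj₂ y∈N) = module-in modN z∈N y∈N (v∉K ∘ N⊆K)

  -- A vertex v of M ∩ N sees M ∖ N in the same way as w does, since N is a module.
  ∖-module : ∀ {M N w} → IsModule T M → IsModule T N → w ∈ N → w ∉ M → IsModule T (M ∩ ∁ N)
  ∖-module {M} {N} {w} modM modN w∈N w∉M = mkModule go
    where
    go : ∀ {x y v} → x ∈ M ∩ ∁ N → y ∈ M ∩ ∁ N → v ∉ M ∩ ∁ N → Arc v x → Arc v y
    go {v = v} x∈ y∈ v∉ vx
      with x∈M , x∈∁N ← x∈p∩q⁻ M (∁ N) x∈ | y∈M , y∈∁N ← x∈p∩q⁻ M (∁ N) y∈ | v ∈? M | v ∈? N
    ... | no v∉M | _ = module-in modM x∈M y∈M v∉M vx
    ... | yes v∈M | no v∉N = contradiction (x∈p∩q⁺ (v∈M , x∉p⇒x∈∁p v∉N)) v∉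
    ... | yes v∈M | yes v∈N =
          module-out modN w∈N v∈N (x∈∁p⇒x∉p y∈∁N)
            (module-in modM x∈M y∈M w∉M (module-out modN v∈N w∈N (x∈∁p⇒x∉p x∈∁N) vx))

  abstract
    isModule? : Decidable (IsModule T)
    isModule? M = all? λ x → all? λ y → all? λ v →
      (x ∈? M) →-dec (y ∈? M) →-dec ¬? (v ∈? M) →-dec
      map′ (λ (f , g) → mk⇔ f g) (λ e → Equivalence.to e , Equivalence.from e)
        ((arc? v x →-dec arc? v y) ×-dec (arc? v y →-dec arc? v x))

    𝓜? : Decidable (𝓜 T)
    𝓜? M = isModule? M ×-dec
      ¬? ((M ≟ˢ ⊥) ⊎-dec any? (λ u → M ≟ˢ ⁅ u ⁆) ⊎-dec (M ≟ˢ ⊤))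

    isCoModule? : Decidable (IsCoModule T)
    isCoModule? M = 𝓜? M ⊎-dec 𝓜? (∁ M)

    mc? : Decidable (mc T)
    mc? M = isCoModule? M ×-dec map′ from-none to-none
      (¬? (anySubset? λ N → isCoModule? N ×-dec (N ⊆? M) ×-dec ¬? (N ≟ˢ M)))
      where
      Smaller : Subset n → Set
      Smaller N = IsCoModule T N × N ⊆ M × N ≢ M
      from-none : ¬ ∃ Smaller → ∀ N → IsCoModule T N → N ⊆ M → N ≡ M
      from-none none N co N⊆M = decidable-stable (N ≟ˢ M) λ N≢M → none (N , co , N⊆M , N≢M)
      to-none : (∀ N → IsCoModule T N → N ⊆ M → N ≡ M) → ¬ ∃ Smaller
      to-none min (N , co , N⊆M , N≢M) = N≢M (min N co N⊆M)

  -- Minimal co-modules and how they overlap.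

  minimal-coModule : ∀ C → IsCoModule T C → ∃[ E ] mc T E × E ⊆ C
  minimal-coModule C = go C (⊂-wellFounded C)
    where
    go : ∀ C → Acc _⊂_ C → IsCoModule T C → ∃[ E ] mc T E × E ⊆ C
    go C (acc rec) co with anySubset? (λ N → isCoModule? N ×-dec (N ⊂? C))
    ... | yes (N , coN , N⊂C) with E , mcE , E⊆N ← go N (rec N⊂C) coN =
          E , mcE , ⊆-trans E⊆N (proj₁ N⊂C)
    ... | no none = C , (co , min) , ⊆-refl
      where
      min : ∀ N → IsCoModule T N → N ⊆ C → N ≡ C
      min N coN N⊆C with ⊆-or-∃ C N
      ... | inj₁ C⊆N = ⊆-antisym N⊆C C⊆N
      ... | inj₂ C⊈N = ⊥-elim (none (N , coN , N⊆C , C⊈N))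

  nontrivial-module : ∀ {M x y v} → IsModule T M → x ∈ M → y ∈ M → x ≢ y → v ∉ M → 𝓜 T M
  nontrivial-module mod x∈M y∈M x≢y v∉M = mod , Proper⇒¬Trivial (_ , _ , _ , x∈M , y∈M , x≢y , v∉M)

  -- The existence of any co-module forces three vertices; this is how small orders are excluded
  -- below.
  coModule-third : ∀ {C} → IsCoModule T C → ∀ x y → ∃[ v ] v ≢ x × v ≢ y
  coModule-third (inj₁ (_ , nt)) = third-vertex (¬Trivial⇒Proper nt)
  coModule-third (inj₂ (_ , nt)) = third-vertex (¬Trivial⇒Proper nt)

  coModule-∃∈ : ∀ {C} → IsCoModule T C → ∃[ v ] v ∈ C
  coModule-∃∈ (inj₁ (_ , nt)) with x , _ , _ , x∈C , _ ← ¬Trivial⇒Proper nt = x , x∈C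
  coModule-∃∈ (inj₂ (_ , nt)) with _ , _ , v , _ , _ , _ , v∉ ← ¬Trivial⇒Proper nt = v , x∉∁p⇒x∈p v∉

  -- Minimality forbids inclusion either way, which yields `a` in `E` only and `b` in `F` only. The
  -- cases then depend on which of the sets and their complements are modules.
  overlapping-mc : ∀ {E F z} → mc T E → mc T F → z ∈ E → z ∈ F → E ≢ F →
    ∃[ a ] a ≢ z × E ≡ pair a z × IsModule T E
  overlapping-mc {E} {F} {z} (coE , minE) (coF , minF) z∈E z∈F E≢F
    with ⊆-or-∃ E F | ⊆-or-∃ F E
  ... | inj₁ E⊆F | _ = contradiction (minF E coE E⊆F) E≢F
  ... | _ | inj₁ F⊆E = contradiction (sym (minE F coF F⊆E)) E≢F
  ... | inj₂ (a , a∈E , a∉F) | inj₂ (b , b∈F , b∉E) = by-type coE coF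
    where
    -- The modules `∁ G` and `H` share `h`, so their union is a module. It is the complement of
    -- `G ∩ ∁ H`, which is thus a co-module inside `G` that misses `z`.
    impossible : ∀ {G H g h} → mc T G → 𝓜 T H → IsModule T (∁ G) →
      z ∈ G → z ∈ H → h ∈ H → h ∉ G → g ∈ G → g ∉ H → Data.Empty.⊥
    impossible {G} {H} {g} {h} (_ , minG) (modH , _) mod∁G z∈G z∈H h∈H h∉G g∈G g∉H =
      x∈∁p⇒x∉p (proj₂ (x∈p∩q⁻ G (∁ H) (subst (z ∈_) (sym G∖H≡G) z∈G))) z∈H
      where
      G∖H≡G : G ∩ ∁ H ≡ G
      G∖H≡G = minG (G ∩ ∁ H)
        (inj₂ (nontrivial-module
          (∪-module mod∁G modH (x∉p⇒x∈∁p h∉G) h∈H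
            (λ v∈∁G → x∉p⇒x∈∁p (x∈∁p⇒x∉p v∈∁G ∘ proj₁ ∘ x∈p∩q⁻ G (∁ H)))
            (λ v∈H → x∉p⇒x∈∁p λ v∈ → x∈∁p⇒x∉p (proj₂ (x∈p∩q⁻ G (∁ H) v∈)) v∈H)
            split)
          (x∉p⇒x∈∁p (h∉G ∘ proj₁ ∘ x∈p∩q⁻ G (∁ H)))
          (x∉p⇒x∈∁p λ z∈ → x∈∁p⇒x∉p (proj₂ (x∈p∩q⁻ G (∁ H) z∈)) z∈H)
          (λ { refl → h∉G z∈G })
          (x∈p⇒x∉∁p (x∈p∩q⁺ (g∈G , x∉p⇒x∈∁p g∉H)))))
        (p∩q⊆p G (∁ H))
        where
        split : ∀ {v} → v ∈ ∁ (G ∩ ∁ H) → v ∈ ∁ G ⊎ v ∈ H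
        split {v} v∈ with v ∈? G | v ∈? H
        ... | no v∉G | _ = inj₁ (x∉p⇒x∈∁p v∉G)
        ... | _ | yes v∈H = inj₂ v∈H
        ... | yes v∈G | no v∉H =
              contradiction (x∈p∩q⁺ (v∈G , x∉p⇒x∈∁p v∉H)) (x∈∁p⇒x∉p v∈)

    -- If `∁ E ⊆ F`, minimality of `F` gives equality, against `z`. Otherwise the complements share
    -- a vertex, their union is a module, and `E ∩ F` is a co-module smaller than `E`.
    both-co : 𝓜 T (∁ E) → 𝓜 T (∁ F) → Data.Empty.⊥
    both-co 𝓜∁E@(mod∁E , _) (mod∁F , _) with ⊆-or-∃ (∁ E) F
    ... | inj₁ ∁E⊆F =
          x∈p⇒x∉∁p z∈E (subst (z ∈_) (sym (minF (∁ E) (inj₁ 𝓜∁E) ∁E⊆F)) z∈F)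
    ... | inj₂ (c , c∈∁E , c∉F) =
          a∉F (proj₂ (x∈p∩q⁻ E F (subst (a ∈_) (sym E∩F≡E) a∈E)))
      where
      split : ∀ {v} → v ∈ ∁ (E ∩ F) → v ∈ ∁ E ⊎ v ∈ ∁ F
      split {v} v∈ with v ∈? E | v ∈? F
      ... | no v∉E | _ = inj₁ (x∉p⇒x∈∁p v∉E)
      ... | _ | no v∉F = inj₂ (x∉p⇒x∈∁p v∉F)
      ... | yes v∈E | yes v∈F = contradiction (x∈p∩q⁺ (v∈E , v∈F)) (x∈∁p⇒x∉p v∈)
      E∩F≡E : E ∩ F ≡ E
      E∩F≡E = minE (E ∩ F)
        (inj₂ (nontrivial-module
          (∪-module mod∁E mod∁F c∈∁E (x∉p⇒x∈∁p c∉F)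
            (λ v∈ → x∉p⇒x∈∁p (x∈∁p⇒x∉p v∈ ∘ proj₁ ∘ x∈p∩q⁻ E F))
            (λ v∈ → x∉p⇒x∈∁p (x∈∁p⇒x∉p v∈ ∘ proj₂ ∘ x∈p∩q⁻ E F))
            split)
          (x∉p⇒x∈∁p (a∉F ∘ proj₂ ∘ x∈p∩q⁻ E F))
          (x∉p⇒x∈∁p (b∉E ∘ proj₁ ∘ x∈p∩q⁻ E F))
          (λ { refl → a∉F b∈F })
          (x∈p⇒x∉∁p (x∈p∩q⁺ (z∈E , z∈F)))))
        (p∩q⊆p E F)

    -- `E ∩ ∁ F` and `E ∩ F` are modules strictly inside `E`, so by minimality they have no elements
    -- besides `a` and `z` respectively.
    both-modules : 𝓜 T E → 𝓜 T F → ∃[ a ] a ≢ z × E ≡ pair a z × IsModule T E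
    both-modules (modE , _) (modF , _) =
      a , (λ { refl → a∉F z∈F }) , ≡-pair a∈E z∈E only , modE
      where
      only : ∀ {v} → v ∈ E → v ≡ a ⊎ v ≡ z
      only {v} v∈E with v ∈? F | v ≟ a | v ≟ z
      ... | _ | yes v≡a | _ = inj₁ v≡a
      ... | _ | _ | yes v≡z = inj₂ v≡z
      ... | no v∉F | no v≢a | _ = contradiction
            (subst (z ∈_) (sym E∖F≡E) z∈E)
            λ z∈ → x∈∁p⇒x∉p (proj₂ (x∈p∩q⁻ E (∁ F) z∈)) z∈F
        where
        E∖F≡E : E ∩ ∁ F ≡ E
        E∖F≡E = minE (E ∩ ∁ F)
          (inj₁ (nontrivial-module (∖-module modE modF b∈F b∉E)
            (x∈p∩q⁺ (v∈E , x∉p⇒x∈∁p v∉F)) (x∈p∩q⁺ (a∈E , x∉p⇒x∈∁p a∉F)) v≢a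
            (b∉E ∘ proj₁ ∘ x∈p∩q⁻ E (∁ F))))
          (p∩q⊆p E (∁ F))
      ... | yes v∈F | _ | no v≢z = contradiction
            (subst (a ∈_) (sym E∩F≡E) a∈E) (a∉F ∘ proj₂ ∘ x∈p∩q⁻ E F)
        where
        E∩F≡E : E ∩ F ≡ E
        E∩F≡E = minE (E ∩ F)
          (inj₁ (nontrivial-module (∩-module modE modF)
            (x∈p∩q⁺ (v∈E , v∈F)) (x∈p∩q⁺ (z∈E , z∈F)) v≢z
            (a∉F ∘ proj₂ ∘ x∈p∩q⁻ E F)))
          (p∩q⊆p E F)

    by-type : IsCoModule T E → IsCoModule T F → ∃[ a ] a ≢ z × E ≡ pair a z × IsModule T E
    by-type (inj₁ 𝓜E) (inj₁ 𝓜F) = both-modules 𝓜E 𝓜F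
    by-type (inj₁ 𝓜E) (inj₂ (mod∁F , _)) =
      ⊥-elim (impossible (coF , minF) 𝓜E mod∁F z∈F z∈E a∈E a∉F b∈F b∉E)
    by-type (inj₂ (mod∁E , _)) (inj₁ 𝓜F) =
      ⊥-elim (impossible (coE , minE) 𝓜F mod∁E z∈E z∈F b∈F b∉E a∈E a∉F)
    by-type (inj₂ 𝓜∁E) (inj₂ 𝓜∁F) = ⊥-elim (both-co 𝓜∁E 𝓜∁F)

  -- Sources and sinks.

  -- That is, `s` is a source or a sink: all other vertices lie on the same side of it.
  Ext : Fin n → Set
  Ext s = IsModule T (∁ ⁅ s ⁆)

  ≢⇒∈∁⁅⁆ : ∀ {s x : Fin n} → x ≢ s → x ∈ ∁ ⁅ s ⁆
  ≢⇒∈∁⁅⁆ x≢s = x∉p⇒x∈∁p (x≢y⇒x∉⁅y⁆ x≢s)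

  s∉∁⁅s⁆ : ∀ (s : Fin n) → s ∉ ∁ ⁅ s ⁆
  s∉∁⁅s⁆ s = x∈p⇒x∉∁p (x∈⁅x⁆ s)

  ext-out : ∀ {s x y} → Ext s → y ≢ s → Arc s x → Arc s y
  ext-out {s} ext y≢s sx =
    module-in ext (≢⇒∈∁⁅⁆ (arc⇒≢ sx ∘ sym)) (≢⇒∈∁⁅⁆ y≢s) (s∉∁⁅s⁆ s) sx

  ext-in : ∀ {s x y} → Ext s → y ≢ s → Arc x s → Arc y s
  ext-in {s} ext y≢s xs =
    module-out ext (≢⇒∈∁⁅⁆ (arc⇒≢ xs)) (≢⇒∈∁⁅⁆ y≢s) (s∉∁⁅s⁆ s) xs

  -- A vertex outside `M` sees `s` and `t` alike, making both sources or both sinks; the arc between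
  -- them forbids this.
  two-ext-fill : ∀ {s t M v} → Ext s → Ext t → s ≢ t → IsModule T M →
    s ∈ M → t ∈ M → ¬ v ∉ M
  two-ext-fill {s} {t} {M} {v} ext-s ext-t s≢t mod s∈M t∈M v∉M with total v≢s
    where
    v≢s : v ≢ s
    v≢s refl = v∉M s∈M
  ... | inj₁ vs = asym (ext-in ext-s (s≢t ∘ sym) vs)
                       (ext-in ext-t s≢t (module-in mod s∈M t∈M v∉M vs))
  ... | inj₂ sv = asym (ext-out ext-s (s≢t ∘ sym) sv)
                       (ext-out ext-t s≢t (module-out mod s∈M t∈M v∉M sv))

  ext⇒coModule : ∀ {s C} → Ext s → IsCoModule T C → IsCoModule T ⁅ s ⁆
  ext⇒coModule {s} ext co
    with x , x≢s , _ ← coModule-third co s s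
    with y , y≢s , y≢x ← coModule-third co s x =
    inj₂ (nontrivial-module ext (≢⇒∈∁⁅⁆ x≢s) (≢⇒∈∁⁅⁆ y≢s) (y≢x ∘ sym) (s∉∁⁅s⁆ s))

  ext-in-mc : ∀ {s C} → Ext s → mc T C → s ∈ C → ∀ {v} → v ∈ C → v ≡ s
  ext-in-mc {s} {C} ext (co , min) s∈C {v} v∈C = x∈⁅y⁆⇒x≡y s (subst (v ∈_) (sym s≡C) v∈C)
    where
    s≡C : ⁅ s ⁆ ≡ C
    s≡C = min ⁅ s ⁆ (ext⇒coModule ext co) λ {u} u∈s → subst (_∈ C) (sym (x∈⁅y⁆⇒x≡y s u∈s)) s∈C

  singleton-coModule⇒ext : ∀ {x C} → IsCoModule T C → x ∈ C → (∀ {v} → v ∈ C → v ≡ x) → Ext x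
  singleton-coModule⇒ext (inj₁ (_ , nt)) x∈C only = contradiction (inj₂ (inj₁ (_ , ≡-singleton x∈C only))) nt
  singleton-coModule⇒ext (inj₂ (mod , _)) x∈C only = subst (IsModule T ∘ ∁) (≡-singleton x∈C only) mod

  -- Twins and scores.

  Twin : Fin n → Fin n → Set
  Twin x y = Arc x y × IsModule T (pair x y)

  twin-out : ∀ {x y v} → Twin x y → v ≢ y → Arc x v → Arc y v
  twin-out (_ , mod) v≢y xv = module-out mod ∈-pairˡ ∈-pairʳ (∉-pair (arc⇒≢ xv ∘ sym) v≢y) xv

  twin-in : ∀ {x y v} → Twin x y → v ≢ x → Arc v y → Arc v x
  twin-in (_ , mod) v≢x vy = module-in mod ∈-pairʳ ∈-pairˡ (∉-pair v≢x (arc⇒≢ vy)) vy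

  twin-out⁻ : ∀ {x y v} → Twin x y → v ≢ x → Arc y v → Arc x v
  twin-out⁻ (_ , mod) v≢x yv = module-out mod ∈-pairʳ ∈-pairˡ (∉-pair v≢x (arc⇒≢ yv ∘ sym)) yv

  -- If `y ≢ z`, then `z` copies the arc from `x` to `y`, and `y` copies the arc from `x` to `z`;
  -- this gives arcs both ways.
  twin-functional : ∀ {x y z} → Twin x y → Twin x z → y ≡ z
  twin-functional {x} {y} {z} xy xz with y ≟ z
  ... | yes y≡z = y≡z
  ... | no y≢z = contradiction (twin-out xz y≢z (proj₁ xy))
                               (asym (twin-out xy (y≢z ∘ sym) (proj₁ xz)))

  twin-injective : ∀ {x y z} → Twin x z → Twin y z → x ≡ y
  twin-injective {x} {y} {z} xz yz with x ≟ y
  ... | yes x≡y = x≡y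
  ... | no x≢y = contradiction (twin-in xz (x≢y ∘ sym) (proj₁ yz))
                               (asym (twin-in yz x≢y (proj₁ xz)))

  pair-module⇒twin : ∀ {x y} → x ≢ y → IsModule T (pair x y) → Twin x y ⊎ Twin y x
  pair-module⇒twin {x} {y} x≢y mod with total x≢y
  ... | inj₁ xy = inj₁ (xy , mod)
  ... | inj₂ yx = inj₂ (yx , subst (IsModule T) (∪-comm ⁅ x ⁆ ⁅ y ⁆) mod)

  score : Fin n → ℕ
  score x = ∣ ⟦ arc? x ⟧ ∣

  -- The out-neighbours of `x` are those of `y` together with `y`. Scores thus bound the walks along
  -- paths and provide the colouring.
  twin-score : ∀ {x y} → Twin x y → score x ≡ suc (score y)
  twin-score {x} {y} xy = trans (cong ∣_∣ (⊆-antisym Out⊆ ⊆Out))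
    (∣p∪⁅x⁆∣≡1+∣p∣ λ y∈ → arc⇒≢ (∈-⟦⟧⁻ (arc? y) y∈) refl)
    where
    Out⊆ : ⟦ arc? x ⟧ ⊆ ⟦ arc? y ⟧ ∪ ⁅ y ⁆
    Out⊆ {v} v∈ with v ≟ y
    ... | yes refl = x∈p∪q⁺ (inj₂ (x∈⁅x⁆ y))
    ... | no v≢y = x∈p∪q⁺ (inj₁ (∈-⟦⟧⁺ (arc? y) (twin-out xy v≢y (∈-⟦⟧⁻ (arc? x) v∈))))
    ⊆Out : ⟦ arc? y ⟧ ∪ ⁅ y ⁆ ⊆ ⟦ arc? x ⟧
    ⊆Out {v} v∈ with x∈p∪q⁻ ⟦ arc? y ⟧ ⁅ y ⁆ v∈
    ... | inj₂ v∈y = ∈-⟦⟧⁺ (arc? x) (subst (Arc x) (sym (x∈⁅y⁆⇒x≡y y v∈y)) (proj₁ xy))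
    ... | inj₁ v∈out with yv ← ∈-⟦⟧⁻ (arc? y) v∈out =
          ∈-⟦⟧⁺ (arc? x) (twin-out⁻ xy (λ { refl → asym (proj₁ xy) yv }) yv)

  source-score : ∀ {s x} → Ext s → Arc s x → suc (score s) ≡ n
  source-score {s} ext sx =
    trans (sym (∣p∪⁅x⁆∣≡1+∣p∣ λ s∈ → arc⇒≢ (∈-⟦⟧⁻ (arc? s) s∈) refl))
      (trans (cong ∣_∣ (⊆-antisym ⊆⊤ ⊤⊆)) (∣⊤∣≡n n))
    where
    ⊤⊆ : ⊤ ⊆ ⟦ arc? s ⟧ ∪ ⁅ s ⁆
    ⊤⊆ {v} _ with v ≟ s
    ... | yes refl = x∈p∪q⁺ (inj₂ (x∈⁅x⁆ s))
    ... | no v≢s = x∈p∪q⁺ (inj₁ (∈-⟦⟧⁺ (arc? s) (ext-out ext v≢s sx)))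

  sink-score : ∀ {t x} → Ext t → Arc x t → score t ≡ 0
  sink-score {t} ext xt = trans (cong ∣_∣ (Empty-unique empty)) (∣⊥∣≡0 n)
    where
    empty : Empty ⟦ arc? t ⟧
    empty (v , v∈) with tv ← ∈-⟦⟧⁻ (arc? t) v∈ = asym tv (ext-in ext (arc⇒≢ tv ∘ sym) xt)

  -- Bad vertices.

  -- The direction of the arc makes `s` a source and `t` a sink.
  BadStart BadEnd Bad : Fin n → Set
  BadStart x = ∃[ s ] Ext s × Twin s x
  BadEnd x = ∃[ t ] Ext t × Twin x t
  Bad x = BadStart x ⊎ BadEnd x

  abstract
    twin? : ∀ x y → Dec (Twin x y)
    twin? x y = arc? x y ×-dec isModule? (pair x y)

    badStart? : Decidable BadStart
    badStart? x = any? λ s → isModule? (∁ ⁅ s ⁆) ×-dec twin? s x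

    bad? : Decidable Bad
    bad? x = badStart? x ⊎-dec any? λ t → isModule? (∁ ⁅ t ⁆) ×-dec twin? x t

  bad-ext : ∀ {x} → Bad x → ∃[ s ] Ext s × s ≢ x × IsModule T (pair s x)
  bad-ext (inj₁ (s , ext , sx , mod)) = s , ext , arc⇒≢ sx , mod
  bad-ext {x} (inj₂ (t , ext , xt , mod)) =
    t , ext , arc⇒≢ xt ∘ sym , subst (IsModule T) (∪-comm ⁅ x ⁆ ⁅ t ⁆) mod

  ext-bad : ∀ {s x} → Ext s → s ≢ x → IsModule T (pair s x) → Bad x
  ext-bad ext s≢x mod with pair-module⇒twin s≢x mod
  ... | inj₁ sx = inj₁ (_ , ext , sx)
  ... | inj₂ xs = inj₂ (_ , ext , xs)

  -- Both arcs at `s` point the same way, since `s` is a source or a sink; twins in a given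
  -- direction are unique.
  ext-neighbour-unique : ∀ {s x y} → Ext s → s ≢ x → IsModule T (pair s x) →
    s ≢ y → IsModule T (pair s y) → x ≡ y
  ext-neighbour-unique ext s≢x modx s≢y mody
    with pair-module⇒twin s≢x modx | pair-module⇒twin s≢y mody
  ... | inj₁ sx | inj₁ sy = twin-functional sx sy
  ... | inj₂ xs | inj₂ ys = twin-injective xs ys
  ... | inj₁ sx | inj₂ ys = contradiction (ext-out ext (s≢y ∘ sym) (proj₁ sx)) (asym (proj₁ ys))
  ... | inj₂ xs | inj₁ sy = contradiction (ext-in ext (s≢y ∘ sym) (proj₁ xs)) (asym (proj₁ sy))

  ext-pair-not-module : ∀ {s t C} → IsCoModule T C → Ext s → Ext t → s ≢ t → ¬ IsModule T (pair s t)
  ext-pair-not-module {s} {t} co ext-s ext-t s≢t mod with v , v≢s , v≢t ← coModule-third co s t =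
    two-ext-fill ext-s ext-t s≢t mod ∈-pairˡ ∈-pairʳ (∉-pair v≢s v≢t)

  -- Minimal co-modules that are pairs of twins.

  infix 4 _⋖_
  _⋖_ : Rel (Fin n) 0ℓ
  x ⋖ y = Twin x y × mc T (pair x y)

  Edge : Subset n → Set
  Edge C = ∃[ x ] ∃[ y ] x ⋖ y × C ≡ pair x y

  abstract
    ⋖? : ∀ x y → Dec (x ⋖ y)
    ⋖? x y = twin? x y ×-dec mc? (pair x y)

    edge? : Decidable Edge
    edge? C = any? λ x → any? λ y → ⋖? x y ×-dec (C ≟ˢ pair x y)

  mc-pair⇒edge : ∀ {C x y} → mc T C → x ≢ y → C ≡ pair x y → IsModule T C →
    (x ⋖ y ⊎ y ⋖ x) × Edge C
  mc-pair⇒edge {x = x} {y} mcC x≢y refl mod with pair-module⇒twin x≢y mod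
  ... | inj₁ xy = inj₁ (xy , mcC) , x , y , (xy , mcC) , refl
  ... | inj₂ yx = inj₂ yx′ , y , x , yx′ , ∪-comm ⁅ x ⁆ ⁅ y ⁆
    where
    yx′ : y ⋖ x
    yx′ = yx , subst (mc T) (∪-comm ⁅ x ⁆ ⁅ y ⁆) mcC

  overlapping⇒edge : ∀ {E F z} → mc T E → mc T F → z ∈ E → z ∈ F → E ≢ F → Edge E
  overlapping⇒edge mcE mcF z∈E z∈F E≢F
    with a , a≢z , E≡ , mod ← overlapping-mc mcE mcF z∈E z∈F E≢F =
    proj₂ (mc-pair⇒edge mcE a≢z E≡ mod)

  -- The predecessor would be the source `s` itself, but a minimal co-module containing `s` has no
  -- other vertex.
  badStart-no-pred : ∀ {p x} → BadStart x → ¬ p ⋖ x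
  badStart-no-pred (s , ext , sx) (px , mcpx) with refl ← twin-injective sx px =
    arc⇒≢ (proj₁ px) (sym (ext-in-mc ext mcpx ∈-pairˡ ∈-pairʳ))

  badEnd-no-succ : ∀ {x y} → BadEnd x → ¬ x ⋖ y
  badEnd-no-succ (t , ext , xt) (xy , mcxy) with refl ← twin-functional xt xy =
    arc⇒≢ (proj₁ xy) (ext-in-mc ext mcxy ∈-pairʳ ∈-pairˡ)

  -- This leaves a vertex that is not bad in every other minimal co-module. `C` contains no source
  -- or sink, so it is not a singleton. A bad vertex is determined by its source or sink, of which
  -- there are at most two, so `C` is a pair. Its complement contains both, hence is not a proper
  -- module.
  all-bad⇒edge : ∀ {C} → mc T C → (∀ {v} → v ∈ C → Bad v) → Edge C
  all-bad⇒edge {C} mcC@(co , _) allbad with x , x∈C ← coModule-∃∈ co = edge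
    where
    no-ext : ∀ {s} → Ext s → s ∉ C
    no-ext ext s∈C with s′ , ext′ , s′≢s , mod ← bad-ext (allbad s∈C) =
      ext-pair-not-module co ext′ ext s′≢s mod

    edge : Edge C
    edge with any? (λ y → (y ∈? C) ×-dec ¬? (x ≟ y))
    ... | no none = contradiction x∈C (no-ext (singleton-coModule⇒ext co x∈C
          λ {v} v∈C → sym (decidable-stable (x ≟ v) λ x≢v → none (v , v∈C , x≢v))))
    ... | yes (y , y∈C , x≢y)
      with s , ext-s , s≢x , modx ← bad-ext (allbad x∈C)
         | t , ext-t , t≢y , mody ← bad-ext (allbad y∈C) =
      proj₂ (mc-pair⇒edge mcC x≢y (≡-pair x∈C y∈C only) (moduleC co))
      where
      s≢t : s ≢ t
      s≢t refl = x≢y (ext-neighbour-unique ext-s s≢x modx t≢y mody)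
      moduleC : IsCoModule T C → IsModule T C
      moduleC (inj₁ (mod , _)) = mod
      moduleC (inj₂ (mod , _)) = ⊥-elim
        (two-ext-fill ext-s ext-t s≢t mod (x∉p⇒x∈∁p (no-ext ext-s)) (x∉p⇒x∈∁p (no-ext ext-t))
          (x∈p⇒x∉∁p x∈C))
      only : ∀ {z} → z ∈ C → z ≡ x ⊎ z ≡ y
      only {z} z∈C with u , ext-u , u≢z , modz ← bad-ext (allbad z∈C) with u ≟ s | u ≟ t
      ... | yes refl | _ = inj₁ (ext-neighbour-unique ext-s u≢z modz s≢x modx)
      ... | _ | yes refl = inj₂ (ext-neighbour-unique ext-t u≢z modz t≢y mody)
      -- A third source or sink `u` would lie outside the module `∁ ⁅ u ⁆`, which contains `s` and
      -- `t`.
      ... | no u≢s | no u≢t = ⊥-elim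
            (two-ext-fill ext-s ext-t s≢t ext-u (≢⇒∈∁⁅⁆ (u≢s ∘ sym)) (≢⇒∈∁⁅⁆ (u≢t ∘ sym)) (s∉∁⁅s⁆ u))

  -- Directed paths of twins.

  infix 4 _⋖*_
  _⋖*_ : Rel (Fin n) 0ℓ
  _⋖*_ = Star _⋖_

  ⋖-functional : ∀ {x y z} → x ⋖ y → x ⋖ z → y ≡ z
  ⋖-functional (xy , _) (xz , _) = twin-functional xy xz

  ⋖-injective : ∀ {x y z} → x ⋖ z → y ⋖ z → x ≡ y
  ⋖-injective (xz , _) (yz , _) = twin-injective xz yz

  last-step : ∀ {x y} → x ⋖* y → x ≡ y ⊎ (∃[ p ] x ⋖* p × p ⋖ y)
  last-step ε = inj₁ refl
  last-step (xz ◅ zy) with last-step zy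
  ... | inj₁ refl = inj₂ (_ , ε , xz)
  ... | inj₂ (p , zp , py) = inj₂ (p , xz ◅ zp , py)

  ⋖*-comparable : ∀ {x a b} → x ⋖* a → x ⋖* b → a ⋖* b ⊎ b ⋖* a
  ⋖*-comparable ε xb = inj₁ xb
  ⋖*-comparable xa ε = inj₂ xa
  ⋖*-comparable (xc ◅ ca) (xd ◅ db) with refl ← ⋖-functional xc xd = ⋖*-comparable ca db

  end-unique : ∀ {x a b} → x ⋖* a → (∀ y → ¬ a ⋖ y) → x ⋖* b → (∀ y → ¬ b ⋖ y) → a ≡ b
  end-unique ε _ ε _ = refl
  end-unique ε a-end (xc ◅ _) _ = contradiction xc (a-end _)
  end-unique (xc ◅ _) _ ε b-end = contradiction xc (b-end _)
  end-unique (xc ◅ ca) a-end (xd ◅ db) b-end with refl ← ⋖-functional xc xd =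
    end-unique ca a-end db b-end

  -- Each vertex copies the arc of its successor to `y`. Returning equality when `y` is `x` avoids a
  -- separate proof of acyclicity.
  path-arc : ∀ {x y} → x ⋖* y → x ≡ y ⊎ Arc x y
  path-arc ε = inj₁ refl
  path-arc {x} {y} (xz@(tw , _) ◅ zy) with path-arc zy | y ≟ x
  ... | inj₁ refl | _ = inj₂ (proj₁ tw)
  ... | _ | yes refl = inj₁ refl
  ... | inj₂ zy′ | no y≢x = inj₂ (twin-out⁻ tw y≢x zy′)

  -- The arc to `v` is handed down from twin to twin, unless some step lands on `v`.
  path-sees : ∀ {x y} v → x ⋖* y → x ⋖* v ⊎ (Arc x v → Arc y v)
  path-sees v ε = inj₂ id
  path-sees v (_◅_ {j = z} xz@(tw , _) zy) with v ≟ z | path-sees v zy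
  ... | yes refl | _ = inj₁ (xz ◅ ε)
  ... | _ | inj₁ zv = inj₁ (xz ◅ zv)
  ... | no v≢z | inj₂ f = inj₂ (f ∘ twin-out tw v≢z)

  badStart-unique : ∀ {a b} → BadStart a → BadStart b → a ≡ b
  badStart-unique (s , ext , sa) (s′ , ext′ , s′b) with s ≟ s′
  ... | yes refl = twin-functional sa s′b
  ... | no s≢s′ = contradiction (ext-out ext (s≢s′ ∘ sym) (proj₁ sa))
                                (asym (ext-out ext′ s≢s′ (proj₁ s′b)))

  -- The path covers everything but `s` and `t`: a vertex off it receives an arc from `s`, hence
  -- from `x` and along the path from `y`, yet it sends one to `t`, hence to `y`. Arcs between path
  -- vertices follow the path.
  bad-path⇒transitive : ∀ {x y} → BadStart x → BadEnd y → x ⋖* y → IsTransitive T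
  bad-path⇒transitive {x} {y} (s , ext-s , sx) (t , ext-t , yt) xy = transitive _ _ _
    where
    from-s : ∀ {v} → v ≢ s → Arc s v
    from-s v≢s = ext-out ext-s v≢s (proj₁ sx)
    into-t : ∀ {v} → v ≢ t → Arc v t
    into-t v≢t = ext-in ext-t v≢t (proj₁ yt)
    ¬into-s : ∀ {v} → ¬ Arc v s
    ¬into-s vs = asym vs (from-s (arc⇒≢ vs))
    ¬from-t : ∀ {v} → ¬ Arc t v
    ¬from-t tv = asym tv (into-t (arc⇒≢ tv ∘ sym))

    on-path : ∀ {v} → v ≢ s → v ≢ t → x ⋖* v
    on-path {v} v≢s v≢t with v ≟ x | path-sees v xy
    ... | yes refl | _ = ε
    ... | _ | inj₁ xv = xv
    ... | no v≢x | inj₂ sees with yv ← sees (twin-out sx v≢x (from-s v≢s)) =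
          contradiction yv (asym (twin-in yt (arc⇒≢ yv ∘ sym) (into-t v≢t)))

    arc⇒path : ∀ {a b} → x ⋖* a → x ⋖* b → Arc a b → a ⋖* b
    arc⇒path xa xb ab with ⋖*-comparable xa xb
    ... | inj₁ a⋖*b = a⋖*b
    ... | inj₂ b⋖*a with path-arc b⋖*a
    ...   | inj₁ refl = ε
    ...   | inj₂ ba = contradiction ab (asym ba)

    transitive : ∀ a b c → Arc a b → Arc b c → Arc a c
    transitive a b c ab bc with a ≟ s | c ≟ t
    ... | yes refl | _ = from-s (λ { refl → ¬into-s bc })
    ... | _ | yes refl = into-t (λ { refl → ¬from-t ab })
    ... | no a≢s | no c≢t with path-arc (arc⇒path xa xb ab ◅◅ arc⇒path xb xc bc)
      where
      xa : x ⋖* a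
      xa = on-path a≢s λ { refl → ¬from-t ab }
      xb : x ⋖* b
      xb = on-path (λ { refl → ¬into-s ab }) (λ { refl → ¬from-t bc })
      xc : x ⋖* c
      xc = on-path (λ { refl → ¬into-s bc }) c≢t
    ...   | inj₁ refl = contradiction bc (asym ab)
    ...   | inj₂ ac = ac

  -- Anchors and the alternating colouring.

  -- Exceptional vertices: their path starts next to a source, so its start is the anchor instead of
  -- its end.
  Exc : Fin n → Set
  Exc x = ∃[ b ] BadStart b × b ⋖* x

  exc-forward : ∀ {x y} → x ⋖ y → Exc x → Exc y
  exc-forward xy (b , bad , bx) = b , bad , bx ◅◅ xy ◅ ε

  exc-backward : ∀ {x y} → x ⋖ y → Exc y → Exc x
  exc-backward xy (b , bad , by) with last-step by
  ... | inj₁ refl = contradiction xy (badStart-no-pred bad)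
  ... | inj₂ (p , bp , py) with refl ← ⋖-injective xy py = b , bad , bp

  abstract
    exc? : Decidable Exc
    -- The search walks backwards. Each step raises the score by one, and scores are at most `n`, so
    -- fuel `n` suffices.
    exc? x = go n x (ℕ.m≤m+n n (score x))
      where
      go : ∀ k x → n ≤ k ℕ.+ score x → Dec (Exc x)
      go k x n≤ with badStart? x | any? (λ p → ⋖? p x)
      ... | yes bad | _ = yes (x , bad , ε)
      ... | no ¬bad | no ¬pred = no λ (b , bad , bx) →
            [ (λ { refl → ¬bad bad }) , (λ (p , _ , px) → ¬pred (p , px)) ]′ (last-step bx)
      go zero x n≤ | no _ | yes (p , px) = contradiction
        (ℕ.≤-trans (ℕ.≤-reflexive (sym (twin-score (proj₁ px)))) (∣p∣≤n ⟦ arc? p ⟧))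
        (ℕ.<⇒≱ (s≤s n≤))
      go (suc k) x n≤ | no _ | yes (p , px) =
        map′ (exc-forward px) (exc-backward px) (go k p
          (ℕ.≤-trans n≤ (ℕ.≤-reflexive (trans (sym (ℕ.+-suc k (score x)))
            (cong (k ℕ.+_) (sym (twin-score (proj₁ px))))))))

    path-end : ∀ x → ∃[ a ] x ⋖* a × (∀ y → ¬ a ⋖ y)
    path-end x = go (score x) x refl
      where
      go : ∀ k x → score x ≡ k → ∃[ a ] x ⋖* a × (∀ y → ¬ a ⋖ y)
      go k x eq with any? (⋖? x)
      ... | no none = x , ε , λ y xy → none (y , xy)
      go zero x eq | yes (y , xy) = contradiction (trans (sym eq) (twin-score (proj₁ xy))) ℕ.0≢1+n
      go (suc k) x eq | yes (y , xy)
        with a , ya , a-end ← go k y (ℕ.suc-injective (trans (sym (twin-score (proj₁ xy))) eq)) =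
        a , xy ◅ ya , a-end

  -- An anchor is an end of the path that is left out of the transversal;
  -- bad ends must be left out.
  IsAnchor : Fin n → Fin n → Set
  IsAnchor x a = (BadStart a × a ⋖* x) ⊎ (¬ Exc x × x ⋖* a × (∀ y → ¬ a ⋖ y))

  abstract
    anchored : ∀ x → ∃ (IsAnchor x)
    anchored x with exc? x | path-end x
    ... | yes (b , bad , bx) | _ = b , inj₁ (bad , bx)
    ... | no ¬exc | a , xa , a-end = a , inj₂ (¬exc , xa , a-end)

  -- Neighbours on a path have the same anchor, so they are coloured against the same reference
  -- score.
  anchor-step : ∀ {x y a b} → x ⋖ y → IsAnchor x a → IsAnchor y b → a ≡ b
  anchor-step xy (inj₁ (bad , _)) (inj₁ (bad′ , _)) = badStart-unique bad bad′
  anchor-step xy (inj₁ (bad , ax)) (inj₂ (¬exc , _)) =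
    contradiction (exc-forward xy (_ , bad , ax)) ¬exc
  anchor-step xy (inj₂ (¬exc , _)) (inj₁ (bad , by)) =
    contradiction (exc-backward xy (_ , bad , by)) ¬exc
  anchor-step xy (inj₂ (_ , ε , x-end)) (inj₂ _) = contradiction xy (x-end _)
  anchor-step xy (inj₂ (_ , xz ◅ za , a-end)) (inj₂ (_ , yb , b-end))
    with refl ← ⋖-functional xy xz = end-unique za a-end yb b-end

  anchor : Fin n → Fin n
  anchor x = proj₁ (anchored x)

  -- Scores drop by one along a path, so this alternates on it.
  Coloured : Fin n → Set
  Coloured x = parity (score x) ≢ parity (score (anchor x))

  abstract
    coloured? : Decidable Coloured
    coloured? x = ¬? (parity (score x) ℙ.≟ parity (score (anchor x)))

  ⋖-coloured : ∀ {x y} → x ⋖ y → (Coloured x × ¬ Coloured y) ⊎ (Coloured y × ¬ Coloured x)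
  ⋖-coloured {x} {y} xy@(tw , _)
    with α≡β ← cong (parity ∘ score) (anchor-step xy (proj₂ (anchored x)) (proj₂ (anchored y))) =
    alternate (parity (score y)) _ α≡β (trans (cong (ℙ._⁻¹ ∘ parity) (twin-score tw)) (ℙ.suc-homo-⁻¹ (score y)))
    where
    alternate : ∀ {p α} q β → α ≡ β → p ℙ.⁻¹ ≡ q → (p ≢ α × ¬ q ≢ β) ⊎ (q ≢ β × ¬ p ≢ α)
    alternate {0ℙ} _ 0ℙ refl refl = inj₂ ((λ ()) , λ p≢α → p≢α refl)
    alternate {0ℙ} _ 1ℙ refl refl = inj₁ ((λ ()) , λ q≢α → q≢α refl)
    alternate {1ℙ} _ 0ℙ refl refl = inj₁ ((λ ()) , λ q≢α → q≢α refl)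
    alternate {1ℙ} _ 1ℙ refl refl = inj₂ ((λ ()) , λ p≢α → p≢α refl)

  -- The neighbour `z` on the side of the anchor: forwards on ordinary paths, backwards on
  -- exceptional ones.
  Toward : Fin n → Fin n → Set
  Toward r z = (r ⋖ z × ¬ Exc r) ⊎ (z ⋖ r × Exc r)

  toward-anchor : ∀ {r} → Coloured r → ∃ (Toward r)
  toward-anchor {r} col with anchored r
  ... | a , inj₁ (bad , ar) with last-step ar
  ...   | inj₁ refl = contradiction refl col
  ...   | inj₂ (p , ap , pr) = p , inj₂ (pr , a , bad , ar)
  toward-anchor {r} col | a , inj₂ (_ , ε , _) = contradiction refl col
  toward-anchor {r} col | a , inj₂ (¬exc , rz ◅ _ , _) = _ , inj₁ (rz , ¬exc)

  -- Being exceptional is constant along a path, so two vertices cannot point at `z` from opposite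
  -- sides.
  toward-injective : ∀ {r r′ z} → Toward r z → Toward r′ z → r ≡ r′
  toward-injective (inj₁ (rz , _)) (inj₁ (r′z , _)) = ⋖-injective rz r′z
  toward-injective (inj₂ (zr , _)) (inj₂ (zr′ , _)) = ⋖-functional zr zr′
  toward-injective (inj₁ (rz , ¬exc)) (inj₂ (zr′ , exc)) =
    contradiction (exc-backward rz (exc-backward zr′ exc)) ¬exc
  toward-injective (inj₂ (zr , exc)) (inj₁ (r′z , ¬exc)) =
    contradiction (exc-backward r′z (exc-backward zr exc)) ¬exc

  toward-edge : ∀ {r z} → Toward r z → mc T (pair r z) × Edge (pair r z)
  toward-edge (inj₁ (rz , _)) = proj₂ rz , _ , _ , rz , refl
  toward-edge {r} {z} (inj₂ (zr , _)) =
    subst (mc T) (∪-comm ⁅ z ⁆ ⁅ r ⁆) (proj₂ zr) , z , r , zr , ∪-comm ⁅ r ⁆ ⁅ z ⁆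

  -- Representatives and the selected vertices.

  rep : Subset n → Maybe (Fin n)
  rep C = Maybe.map proj₁ (dec⇒maybe (any? λ v → (v ∈? C) ×-dec ¬? (bad? v)))

  rep-sound : ∀ C {v} → rep C ≡ just v → v ∈ C × ¬ Bad v
  rep-sound C eq with any? (λ v → (v ∈? C) ×-dec ¬? (bad? v))
  rep-sound C refl | yes (v , v∈C , ¬bad) = v∈C , ¬bad

  rep-defined : ∀ {C} → mc T C → ¬ Edge C → ∃[ v ] rep C ≡ just v
  rep-defined {C} mcC ¬edge with any? (λ v → (v ∈? C) ×-dec ¬? (bad? v))
  ... | yes (v , _) = v , refl
  ... | no none = contradiction
        (all-bad⇒edge mcC λ {v} v∈C → decidable-stable (bad? v) λ ¬bad → none (v , v∈C , ¬bad))
        ¬edge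

  Represents : Fin n → Subset n → Set
  Represents v C = mc T C × ¬ Edge C × rep C ≡ just v

  Selected : Fin n → Set
  Selected v = ∃ (Represents v) ⊎ Coloured v

  abstract
    selected? : Decidable Selected
    selected? v =
      anySubset? (λ C → mc? C ×-dec ¬? (edge? C) ×-dec Maybe.≡-dec _≟_ (rep C) (just v))
      ⊎-dec coloured? v

  -- A minimal co-module that is not an edge is disjoint from all others, so it holds its own
  -- representative and no coloured vertex. An edge holds no representative, and exactly one of its
  -- two vertices is coloured.
  unique-selected : ∀ {F} → mc T F →
    ∃[ r ] r ∈ F × Selected r × (∀ {w} → w ∈ F → Selected w → w ≡ r)
  unique-selected {F} mcF with edge? F
  ... | yes edge@(x , y , xy , refl) = pick (⋖-coloured xy)
    where
    coloured : ∀ {w} → w ∈ F → Selected w → Coloured w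
    coloured w∈F (inj₂ col) = col
    coloured w∈F (inj₁ (C , mcC , ¬edge , rep≡)) = contradiction
      (overlapping⇒edge mcC mcF (proj₁ (rep-sound C rep≡)) w∈F λ { refl → ¬edge edge }) ¬edge
    pick : (Coloured x × ¬ Coloured y) ⊎ (Coloured y × ¬ Coloured x) →
      ∃[ r ] r ∈ F × Selected r × (∀ {w} → w ∈ F → Selected w → w ≡ r)
    pick (inj₁ (col , ¬col)) = x , ∈-pairˡ , inj₂ col , λ w∈F sel →
      [ id , (λ { refl → contradiction (coloured w∈F sel) ¬col }) ]′ (∈-pair⁻ w∈F)
    pick (inj₂ (col , ¬col)) = y , ∈-pairʳ , inj₂ col , λ w∈F sel →
      [ (λ { refl → contradiction (coloured w∈F sel) ¬col }) , id ]′ (∈-pair⁻ w∈F)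
  ... | no ¬edge with v , rep≡ ← rep-defined mcF ¬edge =
        v , proj₁ (rep-sound F rep≡) , inj₁ (F , mcF , ¬edge , rep≡) , only
    where
    only : ∀ {w} → w ∈ F → Selected w → w ≡ v
    only w∈F (inj₁ (C , mcC , ¬edgeC , rep≡′)) with C ≟ˢ F
    ... | yes refl = Maybe.just-injective (trans (sym rep≡′) rep≡)
    ... | no C≢F = contradiction
          (overlapping⇒edge mcC mcF (proj₁ (rep-sound C rep≡′)) w∈F C≢F) ¬edgeC
    only {w} w∈F (inj₂ col)
      with z , wz ← toward-anchor col
      with mcE , edgeE ← toward-edge wz = contradiction
        (overlapping⇒edge mcF mcE w∈F ∈-pairˡ λ { refl → ¬edge edgeE }) ¬edge

  -- Charging selected vertices to disjoint minimal co-modules.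

  Charge : Fin n → Subset n → Set
  Charge r C = mc T C × r ∈ C × (Edge C → ∃[ z ] Toward r z × C ≡ pair r z)

  charge : ∀ {r} → Selected r → ∃ (Charge r)
  charge (inj₁ (C , mcC , ¬edge , rep≡)) =
    C , mcC , proj₁ (rep-sound C rep≡) , λ edge → contradiction edge ¬edge
  charge {r} (inj₂ col) with z , rz ← toward-anchor col =
    pair r z , proj₁ (toward-edge rz) , ∈-pairˡ , λ _ → z , rz , refl

  -- Distinct charged sets that meet are edges. If they meet in `r` or `r′`, one of them contains
  -- two selected vertices; otherwise `r` and `r′` point at the same vertex.
  charge-disjoint : ∀ {r r′ C C′} → Selected r → Selected r′ → r ≢ r′ →
    Charge r C → Charge r′ C′ → Empty (C ∩ C′)
  charge-disjoint {r} {r′} {C} {C′} sel sel′ r≢r′ (mcC , r∈C , edge-C) (mcC′ , r′∈C′ , edge-C′) (v , v∈)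
    with v∈C , v∈C′ ← x∈p∩q⁻ C C′ v∈ = contra
    where
    same : ∀ {F} → mc T F → r ∈ F → r′ ∈ F → r ≡ r′
    same mcF r∈F r′∈F with _ , _ , _ , only ← unique-selected mcF =
      trans (only r∈F sel) (sym (only r′∈F sel′))
    contra : Data.Empty.⊥
    contra with C ≟ˢ C′
    ... | yes refl = r≢r′ (same mcC r∈C r′∈C′)
    ... | no C≢C′
      with z , rz , refl ← edge-C (overlapping⇒edge mcC mcC′ v∈C v∈C′ C≢C′)
         | z′ , r′z′ , refl ← edge-C′ (overlapping⇒edge mcC′ mcC v∈C′ v∈C (C≢C′ ∘ sym))
      with ∈-pair⁻ v∈C | ∈-pair⁻ v∈C′
    ... | inj₁ refl | _ = r≢r′ (same mcC′ v∈C′ r′∈C′)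
    ... | _ | inj₁ refl = r≢r′ (same mcC r∈C v∈C)
    ... | inj₂ refl | inj₂ refl = r≢r′ (toward-injective rz r′z′)

  -- The parity hypothesis and the properties of `R`.

  module _ (not-even-transitive : ¬ (IsTransitive T × 2 ∣ n)) where

    -- The scores of `x` and `y` are `n` minus 2 and 1. The path makes `T` transitive, so `n` is odd
    -- and both scores are odd.
    bad-path-parity : ∀ {x y} → BadStart x → BadEnd y → x ⋖* y → parity (score y) ≡ parity (score x)
    bad-path-parity {x} {y} start@(s , ext-s , sx) end@(t , ext-t , yt) xy =
      trans (cong parity (trans (twin-score yt) (cong suc (sink-score ext-t (proj₁ yt)))))
            (sym odd-x)
      where
      n≡ : n ≡ suc (suc (score x))
      n≡ = trans (sym (source-score ext-s (proj₁ sx))) (cong suc (twin-score sx))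
      odd-x : parity (score x) ≡ 1ℙ
      odd-x with parity (score x) in eq
      ... | 1ℙ = refl
      ... | 0ℙ = ⊥-elim (not-even-transitive
            (bad-path⇒transitive start end xy , even⇒2∣ n (trans (cong parity n≡) eq)))

    -- Representatives are not bad by choice. A bad vertex is its own anchor, or it ends a path with
    -- a bad start, and then its parity is that of the anchor.
    bad⇒¬selected : ∀ {v} → Bad v → ¬ Selected v
    bad⇒¬selected bad (inj₁ (C , _ , _ , rep≡)) = proj₂ (rep-sound C rep≡) bad
    bad⇒¬selected {v} bad (inj₂ col) with anchored v | bad
    ... | a , inj₁ (bad-a , _) | inj₁ start =
          col (cong (parity ∘ score) (badStart-unique start bad-a))
    ... | a , inj₂ (¬exc , _) | inj₁ start = ¬exc (v , start , ε)
    ... | a , inj₁ (bad-a , av) | inj₂ end = col (bad-path-parity bad-a end av)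
    ... | a , inj₂ (_ , ε , _) | inj₂ end = col refl
    ... | a , inj₂ (_ , vz ◅ _ , _) | inj₂ end = badEnd-no-succ end vz

    -- A minimal co-module inside `M` has one selected vertex, hence one vertex, which is then a
    -- source or a sink.
    ext-inside : ∀ {M} → 𝓜 T M → (∀ {v} → v ∈ M → Selected v) → ∃[ s ] s ∈ M × Ext s
    ext-inside {M} 𝓜M all-selected
      with C , mcC , C⊆M ← minimal-coModule M (inj₁ 𝓜M)
      with r , r∈C , _ , only ← unique-selected mcC =
      r , C⊆M r∈C ,
      singleton-coModule⇒ext (proj₁ mcC) r∈C λ v∈C → only v∈C (all-selected (C⊆M v∈C))

    -- `M` contains a source or sink `s`. If `M` is a pair, its other vertex is bad. Otherwise `M`
    -- without `s` is a nontrivial module and contains a second source or sink, so `M` would be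
    -- everything.
    module-⊈-selected : ∀ {M} → 𝓜 T M → ¬ (∀ {v} → v ∈ M → Selected v)
    module-⊈-selected {M} 𝓜M@(mod , nt) all-selected
      with s , s∈M , ext-s ← ext-inside 𝓜M all-selected
         | x , y , v , x∈M , y∈M , x≢y , v∉M ← ¬Trivial⇒Proper nt
      with ⊆-or-∃ M ⁅ s ⁆
    ... | inj₁ M⊆s = x≢y (trans (x∈⁅y⁆⇒x≡y s (M⊆s x∈M)) (sym (x∈⁅y⁆⇒x≡y s (M⊆s y∈M))))
    ... | inj₂ (a , a∈M , a∉s) with ⊆-or-∃ M (pair s a)
    ...   | inj₁ M⊆pair = bad⇒¬selected
            (ext-bad ext-s (x∉⁅y⁆⇒x≢y a∉s ∘ sym)
              (subst (IsModule T) (≡-pair s∈M a∈M (∈-pair⁻ ∘ M⊆pair)) mod))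
            (all-selected a∈M)
    ...   | inj₂ (b , b∈M , b∉pair)
      with t , t∈ , ext-t ← ext-inside
             (nontrivial-module (∩-module mod ext-s)
               (x∈p∩q⁺ (a∈M , x∉p⇒x∈∁p a∉s))
               (x∈p∩q⁺ (b∈M , ≢⇒∈∁⁅⁆ λ { refl → b∉pair ∈-pairˡ }))
               (λ { refl → b∉pair ∈-pairʳ })
               (v∉M ∘ proj₁ ∘ x∈p∩q⁻ M (∁ ⁅ s ⁆)))
             (all-selected ∘ proj₁ ∘ x∈p∩q⁻ M (∁ ⁅ s ⁆))
      with t∈M , t∈∁s ← x∈p∩q⁻ M (∁ ⁅ s ⁆) t∈ =
      two-ext-fill ext-s ext-t (λ { refl → s∉∁⁅s⁆ s t∈∁s }) mod s∈M t∈M v∉M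

    R : Subset n
    R = ⟦ selected? ⟧

    R-transversal : IsTransversal (mc T) R
    R-transversal F mcF with r , r∈F , sel , _ ← unique-selected mcF =
      r , x∈p∩q⁺ (r∈F , ∈-⟦⟧⁺ selected? sel)

    R-exact : IsExactTransversal (mc T) R
    R-exact = R-transversal , λ F mcF →
      let r , r∈F , sel , only = unique-selected mcF in
      unique⇒∣∣≡1 (x∈p∩q⁺ (r∈F , ∈-⟦⟧⁺ selected? sel)) λ v∈ →
        let v∈F , v∈R = x∈p∩q⁻ F R v∈ in only v∈F (∈-⟦⟧⁻ selected? v∈R)

    R-meets : ∀ {C} → IsCoModule T C → ∃[ r ] r ∈ C × r ∈ R
    R-meets {C} co
      with E , mcE , E⊆C ← minimal-coModule C co
      with r , r∈E , sel , _ ← unique-selected mcE = r , E⊆C r∈E , ∈-⟦⟧⁺ selected? sel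

    -- `M` and `∁ M` are both co-modules, so each contains a minimal one and with it a point of `R`.
    R-overlaps : StrictlyBipartiteBy (𝓜 T) R
    R-overlaps M 𝓜M = meets , R⊈M (R-meets ∁M-co) , M⊈R (⊆-or-∃ M R)
      where
      ∁M-co : IsCoModule T (∁ M)
      ∁M-co = inj₂ (subst (𝓜 T) (⊆-antisym
        (λ v∈M → x∉p⇒x∈∁p (x∈p⇒x∉∁p v∈M))
        (λ v∈ → x∉∁p⇒x∈p (x∈∁p⇒x∉p v∈))) 𝓜M)
      meets : Nonempty (R ∩ M)
      meets with r , r∈M , r∈R ← R-meets (inj₁ 𝓜M) = r , x∈p∩q⁺ (r∈R , r∈M)
      R⊈M : (∃[ r ] r ∈ ∁ M × r ∈ R) → Nonempty (R ─ M)
      R⊈M (r , r∈∁M , r∈R) = r , x∈p∧x∉q⇒x∈p─q r∈R (x∈∁p⇒x∉p r∈∁M)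
      M⊈R : M ⊆ R ⊎ (∃[ v ] v ∈ M × v ∉ R) → Nonempty (M ─ R)
      M⊈R (inj₁ M⊆R) = contradiction (λ {v} v∈M → ∈-⟦⟧⁻ selected? (M⊆R v∈M)) (module-⊈-selected 𝓜M)
      M⊈R (inj₂ (v , v∈M , v∉R)) = v , x∈p∧x∉q⇒x∈p─q v∈M v∉R

    charged : ∀ r → ∃[ C ] (r ∈ R → Charge r C)
    charged r with r ∈? R
    ... | yes r∈R with C , ch ← charge (∈-⟦⟧⁻ selected? r∈R) = C , λ _ → ch
    -- Default value outside `R`, making `member` total.
    ... | no r∉R = ⊥ , λ r∈R → contradiction r∈R r∉R

    member : Fin n → Subset n
    member = proj₁ ∘ charged

    member-charge : ∀ {r} → r ∈ R → Charge r (member r)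
    member-charge {r} = proj₂ (charged r)

    member-disjoint : ∀ {r r′} → r ∈ R → r′ ∈ R → r ≢ r′ → Empty (member r ∩ member r′)
    member-disjoint r∈R r′∈R r≢r′ = charge-disjoint
      (∈-⟦⟧⁻ selected? r∈R) (∈-⟦⟧⁻ selected? r′∈R) r≢r′ (member-charge r∈R) (member-charge r′∈R)

    R-minimum : IsMinimumTransversal (mc T) R
    R-minimum = charged⇒minimum R-transversal member
      (proj₁ ∘ member-charge) (proj₁ ∘ proj₂ ∘ member-charge) member-disjoint

    R-König : König (mc T)
    R-König = charged⇒König R-transversal member
      (proj₁ ∘ member-charge) (proj₁ ∘ proj₂ ∘ member-charge) member-disjoint

theorem3p2 : ∀ (n : ℕ) (T : Tournament n) →
    ¬ (IsTransitive T × 2 ∣ n) →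
    (∃[ R ] (IsExactTransversal (mc T) R × IsMinimumTransversal (mc T) R × StrictlyBipartiteBy (𝓜 T) R)) × König (mc T)
theorem3p2 n T h = (R T h , R-exact T h , R-minimum T h , R-overlaps T h) , R-König T h
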